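{- Let $n$ be an odd positive integer and let $m=2^l m_1$, where $m_1$ is an odd positive integer and $l\ge 1$ is an integer. Then \[K(\mathbb{Z}_m^n)=\{(x_1,x_2,\dots,x_n)\in\mathbb{Z}_m^n \mid x_1+x_2+\cdots+x_n\equiv 0 \bmod 2^l\}.\]
   Context: For positive integers $m,n$, the Ducci function is the map $D:\mathbb{Z}_m^n\to\mathbb{Z}_m^n$ (where $\mathbb{Z}_m=\mathbb{Z}/m\mathbb{Z}$) given by $D(x_1,x_2,\dots,x_n)=(x_1+x_2,\,x_2+x_3,\,\dots,\,x_n+x_1)$, all entries taken modulo $m$ (indices are cyclic modulo $n$; for $n=1$, $D(x_1)=(2x_1)$). $D^{\alpha}$ denotes the $\alpha$-fold iterate, $D^0$ being the identity. The Ducci cycle of $\mathbf{v}\in\mathbb{Z}_m^n$ is the set of all $\mathbf{w}$ for which there exist integers $\alpha\ge 0$ and $\beta\ge 1$ with $\mathbf{w}=D^{\alpha+\beta}(\mathbf{v})=D^{\alpha}(\mathbf{v})$. $K(\mathbb{Z}_m^n)$ is the set of all $\mathbf{u}\in\mathbb{Z}_m^n$ that lie in the Ducci cycle of some $\mathbf{v}\in\mathbb{Z}_m^n$. The congruence modulo $2^l$ is well defined on elements of $\mathbb{Z}_m$ because $2^l\mid m$. -}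

module Defs where

open import Data.Fin.Base using (Fin; toℕ)
open import Data.Nat.Base as ℕ using (ℕ; NonZero; _≤_; ∣_-_∣)
open import Data.Nat.DivMod using (_mod_)
open import Data.Nat.Divisibility using (_∣_)
open import Data.Product.Base using (∃; ∃₂; _×_)
open import Data.Vec.Base using (Vec; []; _∷_; _∷ʳ_; zipWith; foldr′)
import Function.Endo.Propositional as Endo
open import Level using (0ℓ)
open import Relation.Binary.PropositionalEquality.Core using (_≡_)
open import Relation.Unary using (Pred; _∈_)

-- Each residue class is represented by its element in {0, …, m - 1}.
ℤ/ : ℕ → Set
ℤ/ m = Fin m

module _ {m : ℕ} .{{_ : NonZero m}} where

  infixl 6 _+_

  _+_ : ℤ/ m → ℤ/ m → ℤ/ m
  x + y = (toℕ x ℕ.+ toℕ y) mod m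

  0# : ℤ/ m
  0# = 0 mod m

  sum : ∀ {n} → Vec (ℤ/ m) n → ℤ/ m
  sum = foldr′ _+_ 0#

-- Meaningful for residue classes modulo m only when d ∣ m: then it does not
-- depend on the choice of representatives.
infix 4 _≡_[mod_]

_≡_[mod_] : ∀ {m} → ℤ/ m → ℤ/ m → ℕ → Set
x ≡ y [mod d ] = d ∣ ∣ toℕ x - toℕ y ∣

module _ {m : ℕ} .{{_ : NonZero m}} {n : ℕ} where

  open Endo (Vec (ℤ/ m) n) using (_^_)

  D : Vec (ℤ/ m) n → Vec (ℤ/ m) n
  D []       = []
  D (x ∷ xs) = zipWith _+_ (x ∷ xs) (xs ∷ʳ x)

  DucciCycle : Vec (ℤ/ m) n → Pred (Vec (ℤ/ m) n) 0ℓ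
  DucciCycle v w = ∃₂ λ α β → 1 ≤ β ×
    w ≡ (D ^ (α ℕ.+ β)) v × (D ^ (α ℕ.+ β)) v ≡ (D ^ α) v

K : (m n : ℕ) .{{_ : NonZero m}} → Pred (Vec (ℤ/ m) n) 0ℓ
K m n u = ∃ λ v → u ∈ DucciCycle v

{-# OPTIONS --safe #-}
module Submission where

-- Since sum (D x) = 2 sum x and every element of a cycle is D of an element of
-- a cycle, the sum of an element of a cycle is divisible by every power of 2
-- that divides m.  Conversely, D maps the finite set of vectors with sum
-- divisible by 2ˡ into itself, so it suffices that D is injective there: if
-- D x = D y, the entries of x - y are d, -d, d, …, and as n is odd, closing up
-- the cycle gives 2d = 0 while the sum gives d ≡ 0 mod 2ˡ, whence d = 0.

open import Defs
open import Data.Nat.Base using (ℕ; NonZero; _≤_; _*_; _^_)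
open import Data.Nat.Divisibility using (_∤_)
open import Relation.Binary.PropositionalEquality.Core using (_≡_)
open import Relation.Unary using (_≐_)

open import Data.Fin.Base using (toℕ; funToFin; finToFun)
open import Data.Fin.Properties
  using (toℕ<n; toℕ-fromℕ<; toℕ-injective; pigeonhole; finToFun-funToFin)
open import Data.Integer.Base as ℤ using (ℤ; +_; _-_)
open import Data.Integer.Divisibility.Signed
import Data.Integer.Properties as ℤ
open import Data.Integer.Tactic.RingSolver using (solve-∀)
open import Data.Nat.Base as ℕ using (zero; suc; _<_; _%_; _/_; s≤s; z≤n; s<s⁻¹)
open import Data.Nat.Coprimality using (Coprime; coprime-divisor)
open import Data.Nat.DivMod using (m%n<n; m≡m%n+[m/n]*n; m*n%n≡0)
import Data.Nat.Divisibility as ℕ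
open import Data.Nat.Primality using (irreducible[2])
import Data.Nat.Properties as ℕ
open import Data.Product.Base using (∃; _×_; _,_; proj₁; proj₂)
open import Data.Sum.Base using (inj₁; inj₂)
open import Data.Vec.Base using (Vec; []; _∷_; _∷ʳ_; zipWith; lookup; tabulate)
open import Data.Vec.Properties using (∷-injective; tabulate∘lookup; tabulate-cong)
import Function.Endo.Propositional as Endo
open import Relation.Binary.PropositionalEquality
  using (refl; sym; trans; cong; cong₂; cong-app; subst; subst₂; module ≡-Reasoning)
open import Relation.Nullary.Negation using (contradiction)
open import Relation.Unary using (_∈_)

-- Oddness, and vectors as elements of a finite set.

2∤⇒coprime : ∀ {a} → 2 ∤ a → Coprime a 2
2∤⇒coprime 2∤a {d} (d∣a , d∣2) with irreducible[2] d∣2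
... | inj₁ d≡1  = d≡1
... | inj₂ refl = contradiction d∣a 2∤a

-- Makes `funToFin` of the entries a code with values in `Fin (m ^ n)`, so that the pigeonhole
-- principle applies to vectors.
lookup-funToFin-injective : ∀ {m n} {u v : Vec (ℤ/ m) n} →
  funToFin (lookup u) ≡ funToFin (lookup v) → u ≡ v
lookup-funToFin-injective {u = u} {v} eq = begin
  u                                     ≡⟨ tabulate∘lookup u ⟨
  tabulate (lookup u)                   ≡⟨ tabulate-cong lookup≗ ⟩
  tabulate (lookup v)                   ≡⟨ tabulate∘lookup v ⟩
  v                                     ∎
  where
  open ≡-Reasoning
  lookup≗ : ∀ i → lookup u i ≡ lookup v i
  lookup≗ i = begin
    lookup u i                          ≡⟨ finToFun-funToFin (lookup u) i ⟨
    finToFun (funToFin (lookup u)) i    ≡⟨ cong (λ c → finToFun c i) eq ⟩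
    finToFun (funToFin (lookup v)) i    ≡⟨ finToFun-funToFin (lookup v) i ⟩
    lookup v i                          ∎

-- Residue classes through their integer representatives.

⟦_⟧ : ∀ {m} → ℤ/ m → ℤ
⟦ x ⟧ = + toℕ x

-- Both representatives lie below `m`, so their difference is smaller than `m` in absolute value,
-- and the only such multiple of `m` is 0.
∣-difference⇒≡ : ∀ {m} (x y : ℤ/ m) → + m ∣ ⟦ x ⟧ - ⟦ y ⟧ → x ≡ y
∣-difference⇒≡ {m} x y m∣x-y =
  toℕ-injective (ℤ.+-injective (ℤ.i-j≡0⇒i≡j ⟦ x ⟧ ⟦ y ⟧ (ℤ.∣i∣≡0⇒i≡0 (below _ small (∣⇒∣ᵤ m∣x-y)))))
  where
  small : ℤ.∣ ⟦ x ⟧ - ⟦ y ⟧ ∣ < m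
  small = subst (λ i → ℤ.∣ i ∣ < m) (sym (ℤ.m-n≡m⊖n (toℕ x) (toℕ y)))
    (ℕ.≤-<-trans (ℤ.∣m⊝n∣≤m⊔n (toℕ x) (toℕ y)) (ℕ.⊔-lub (toℕ<n x) (toℕ<n y)))
  below : ∀ k → k < m → m ℕ.∣ k → k ≡ 0
  below zero    _   _   = refl
  below (suc _) k<m m∣k = contradiction m∣k (ℕ.>⇒∤ k<m)

module _ {m : ℕ} .{{_ : NonZero m}} where

  -- The discrepancy is minus the quotient by `m`, times `m`. Later congruences are sums and
  -- differences of instances of this one, matched to their goals by integer ring identities.
  ⟦+⟧ : ∀ (x y : ℤ/ m) → + m ∣ ⟦ x + y ⟧ - (⟦ x ⟧ ℤ.+ ⟦ y ⟧)
  ⟦+⟧ x y = subst (+ m ∣_) (sym difference) (∣m⇒∣-m (∣n⇒∣m*n q ∣-refl))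
    where
    open ≡-Reasoning
    s = toℕ x ℕ.+ toℕ y
    q = + (s / m)
    cancel : ∀ a b → a - (a ℤ.+ b) ≡ ℤ.- b
    cancel = solve-∀
    difference : ⟦ x + y ⟧ - + s ≡ ℤ.- (q ℤ.* + m)
    difference = begin
      ⟦ x + y ⟧ - + s
        ≡⟨ cong₂ (λ a b → + a - + b) (toℕ-fromℕ< (m%n<n s m)) (m≡m%n+[m/n]*n s m) ⟩
      + (s % m) - (+ (s % m) ℤ.+ + ((s / m) * m))
        ≡⟨ cancel (+ (s % m)) (+ ((s / m) * m)) ⟩
      ℤ.- (+ ((s / m) * m))
        ≡⟨ cong ℤ.-_ (ℤ.pos-* (s / m) m) ⟩
      ℤ.- (q ℤ.* + m) ∎

  toℕ-0# : toℕ (0# {m}) ≡ 0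
  toℕ-0# = trans (toℕ-fromℕ< (m%n<n 0 m)) (m*n%n≡0 0 m)

  ⟦0#⟧ : + m ∣ ⟦ 0# {m} ⟧
  ⟦0#⟧ = subst (λ k → + m ∣ + k) (sym toℕ-0#) (∣ᵤ⇒∣ (m ℕ.∣0))

  ≡⇒∣-difference : ∀ {x y x′ y′ : ℤ/ m} → x + x′ ≡ y + y′ →
    + m ∣ (⟦ x ⟧ ℤ.+ ⟦ x′ ⟧) - (⟦ y ⟧ ℤ.+ ⟦ y′ ⟧)
  ≡⇒∣-difference {x} {y} {x′} {y′} eq = subst (+ m ∣_)
    (cancel ⟦ y + y′ ⟧ (⟦ x ⟧ ℤ.+ ⟦ x′ ⟧) (⟦ y ⟧ ℤ.+ ⟦ y′ ⟧))
    (∣m∣n⇒∣m-n (⟦+⟧ y y′) (subst (λ z → + m ∣ ⟦ z ⟧ - (⟦ x ⟧ ℤ.+ ⟦ x′ ⟧)) eq (⟦+⟧ x x′)))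
    where
    cancel : ∀ c a b → (c - b) - (c - a) ≡ a - b
    cancel = solve-∀

  +-cancelˡ : ∀ (x y z : ℤ/ m) → x + y ≡ x + z → y ≡ z
  +-cancelˡ x y z eq = ∣-difference⇒≡ y z
    (subst (+ m ∣_) (cancel ⟦ x ⟧ ⟦ y ⟧ ⟦ z ⟧) (≡⇒∣-difference {x} {x} {y} {z} eq))
    where
    cancel : ∀ x y z → (x ℤ.+ y) - (x ℤ.+ z) ≡ y - z
    cancel = solve-∀

  -- Sums of vectors and the effect of `D` on them.

  sum-zipWith : ∀ {n} (xs ys : Vec (ℤ/ m) n) →
    + m ∣ ⟦ sum (zipWith _+_ xs ys) ⟧ - (⟦ sum xs ⟧ ℤ.+ ⟦ sum ys ⟧)
  sum-zipWith [] [] = subst (+ m ∣_) (cancel ⟦ 0# ⟧) (∣m⇒∣-m ⟦0#⟧)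
    where
    cancel : ∀ z → ℤ.- z ≡ z - (z ℤ.+ z)
    cancel = solve-∀
  sum-zipWith (x ∷ xs) (y ∷ ys) = subst (+ m ∣_)
    (combine ⟦ (x + y) + Z ⟧ ⟦ x + y ⟧ ⟦ Z ⟧ ⟦ x ⟧ ⟦ y ⟧ ⟦ X ⟧ ⟦ Y ⟧ ⟦ x + X ⟧ ⟦ y + Y ⟧)
    (∣m∣n⇒∣m-n
      (∣m∣n⇒∣m+n (∣m∣n⇒∣m+n (⟦+⟧ (x + y) Z) (⟦+⟧ x y)) (sum-zipWith xs ys))
      (∣m∣n⇒∣m+n (⟦+⟧ x X) (⟦+⟧ y Y)))
    where
    X = sum xs
    Y = sum ys
    Z = sum (zipWith _+_ xs ys)
    combine : ∀ t s z x y X Y x+X y+Y →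
      ((t - (s ℤ.+ z)) ℤ.+ (s - (x ℤ.+ y)) ℤ.+ (z - (X ℤ.+ Y))) -
        ((x+X - (x ℤ.+ X)) ℤ.+ (y+Y - (y ℤ.+ Y)))
      ≡ t - (x+X ℤ.+ y+Y)
    combine = solve-∀

  sum-∷ʳ : ∀ {n} (xs : Vec (ℤ/ m) n) a → + m ∣ ⟦ sum (xs ∷ʳ a) ⟧ - (⟦ a ⟧ ℤ.+ ⟦ sum xs ⟧)
  sum-∷ʳ []       a = ⟦+⟧ a 0#
  sum-∷ʳ (x ∷ xs) a = subst (+ m ∣_)
    (combine ⟦ x + Y ⟧ ⟦ x ⟧ ⟦ Y ⟧ ⟦ a ⟧ ⟦ X ⟧ ⟦ x + X ⟧)
    (∣m∣n⇒∣m-n (∣m∣n⇒∣m+n (⟦+⟧ x Y) (sum-∷ʳ xs a)) (⟦+⟧ x X))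
    where
    X = sum xs
    Y = sum (xs ∷ʳ a)
    combine : ∀ t x Y a X x+X →
      ((t - (x ℤ.+ Y)) ℤ.+ (Y - (a ℤ.+ X))) - (x+X - (x ℤ.+ X)) ≡ t - (a ℤ.+ x+X)
    combine = solve-∀

  -- Each entry is counted twice: once in the vector itself and once in its rotation.
  sum-D : ∀ {n} (x : Vec (ℤ/ m) n) → + m ∣ ⟦ sum (D x) ⟧ - + 2 ℤ.* ⟦ sum x ⟧
  sum-D [] = subst (+ m ∣_) (negate ⟦ 0# ⟧) (∣m⇒∣-m ⟦0#⟧)
    where
    negate : ∀ z → ℤ.- z ≡ z - + 2 ℤ.* z
    negate = solve-∀
  sum-D (x ∷ xs) = subst (+ m ∣_)
    (combine ⟦ sum (D (x ∷ xs)) ⟧ ⟦ x + sum xs ⟧ ⟦ sum (xs ∷ʳ x) ⟧ ⟦ x ⟧ ⟦ sum xs ⟧)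
    (∣m∣n⇒∣m-n
      (∣m∣n⇒∣m+n (sum-zipWith (x ∷ xs) (xs ∷ʳ x)) (sum-∷ʳ xs x))
      (⟦+⟧ x (sum xs)))
    where
    combine : ∀ t s r x X →
      ((t - (s ℤ.+ r)) ℤ.+ (r - (x ℤ.+ X))) - (s - (x ℤ.+ X)) ≡ t - + 2 ℤ.* s
    combine = solve-∀

  ∣2*sum⇒∣sum-D : ∀ {d n} (x : Vec (ℤ/ m) n) → + d ∣ + m →
    + d ∣ + 2 ℤ.* ⟦ sum x ⟧ → + d ∣ ⟦ sum (D x) ⟧
  ∣2*sum⇒∣sum-D x d∣m d∣2s =
    subst (_ ∣_) (cancel ⟦ sum (D x) ⟧ (+ 2 ℤ.* ⟦ sum x ⟧)) (∣m∣n⇒∣m+n (∣-trans d∣m (sum-D x)) d∣2s)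
    where
    cancel : ∀ a b → (a - b) ℤ.+ b ≡ a
    cancel = solve-∀

  -- The entries of the difference of the two vectors alternate in sign, so
  -- that an odd number of them adds up to the first one.
  differences-alternate : ∀ {k} → 2 ∤ suc k → ∀ x y (xs ys : Vec (ℤ/ m) k) a b →
    zipWith _+_ (x ∷ xs) (xs ∷ʳ a) ≡ zipWith _+_ (y ∷ ys) (ys ∷ʳ b) →
    (+ m ∣ (⟦ x ⟧ ℤ.+ ⟦ a ⟧) - (⟦ y ⟧ ℤ.+ ⟦ b ⟧)) ×
    (+ m ∣ (⟦ sum (x ∷ xs) ⟧ - ⟦ sum (y ∷ ys) ⟧) - (⟦ x ⟧ - ⟦ y ⟧))
  differences-alternate _ x y [] [] a b eq =
    ≡⇒∣-difference {x} {y} {a} {b} (proj₁ (∷-injective eq)) ,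
    subst (+ m ∣_) (combine ⟦ x + 0# ⟧ ⟦ y + 0# ⟧ ⟦ x ⟧ ⟦ y ⟧ ⟦ 0# ⟧) (∣m∣n⇒∣m-n (⟦+⟧ x 0#) (⟦+⟧ y 0#))
    where
    combine : ∀ s t x y z → (s - (x ℤ.+ z)) - (t - (y ℤ.+ z)) ≡ (s - t) - (x - y)
    combine = solve-∀
  -- The recursion drops two entries at a time; parity rules out ending at length two.
  differences-alternate odd _ _ (_ ∷ []) (_ ∷ []) _ _ _ = contradiction ℕ.∣-refl odd
  differences-alternate odd x y (x₁ ∷ x₂ ∷ xs) (y₁ ∷ y₂ ∷ ys) a b eq
    with eq₁ , eq′ ← ∷-injective eq
    with eq₂ , eq″ ← ∷-injective eq′
    with ends , sums ← differences-alternate (λ 2∣ → odd (ℕ.∣m∣n⇒∣m+n ℕ.∣-refl 2∣)) x₂ y₂ xs ys a b eq″ =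
    -- By `e₁` and `e₂` the first and third differences agree, which carries `ends` over to the
    -- front. By `e₂` the second and third differences cancel, so the total reduces to the first
    -- one.
    subst (+ m ∣_) (combine₁ ⟦ x ⟧ ⟦ y ⟧ ⟦ x₁ ⟧ ⟦ y₁ ⟧ ⟦ x₂ ⟧ ⟦ y₂ ⟧ ⟦ a ⟧ ⟦ b ⟧)
      (∣m∣n⇒∣m+n (∣m∣n⇒∣m-n e₁ e₂) ends) ,
    subst (+ m ∣_)
      (combine₂ ⟦ x ⟧ ⟦ y ⟧ ⟦ x₁ ⟧ ⟦ y₁ ⟧ ⟦ x₂ ⟧ ⟦ y₂ ⟧ ⟦ X ⟧ ⟦ Y ⟧
        ⟦ x₁ + X ⟧ ⟦ y₁ + Y ⟧ ⟦ x + (x₁ + X) ⟧ ⟦ y + (y₁ + Y) ⟧)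
      (∣m∣n⇒∣m+n
        (∣m∣n⇒∣m+n
          (∣m∣n⇒∣m-n (⟦+⟧ x (x₁ + X)) (⟦+⟧ y (y₁ + Y)))
          (∣m∣n⇒∣m-n (⟦+⟧ x₁ X) (⟦+⟧ y₁ Y)))
        (∣m∣n⇒∣m+n sums e₂))
    where
    X = sum (x₂ ∷ xs)
    Y = sum (y₂ ∷ ys)
    e₁ = ≡⇒∣-difference {x} {y} {x₁} {y₁} eq₁
    e₂ = ≡⇒∣-difference {x₁} {y₁} {x₂} {y₂} eq₂
    combine₁ : ∀ x y x₁ y₁ x₂ y₂ a b →
      (((x ℤ.+ x₁) - (y ℤ.+ y₁)) - ((x₁ ℤ.+ x₂) - (y₁ ℤ.+ y₂))) ℤ.+ ((x₂ ℤ.+ a) - (y₂ ℤ.+ b))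
      ≡ (x ℤ.+ a) - (y ℤ.+ b)
    combine₁ = solve-∀
    combine₂ : ∀ x y x₁ y₁ x₂ y₂ X Y x₁+X y₁+Y s t →
      ((s - (x ℤ.+ x₁+X)) - (t - (y ℤ.+ y₁+Y))) ℤ.+ ((x₁+X - (x₁ ℤ.+ X)) - (y₁+Y - (y₁ ℤ.+ Y))) ℤ.+
        (((X - Y) - (x₂ - y₂)) ℤ.+ ((x₁ ℤ.+ x₂) - (y₁ ℤ.+ y₂)))
      ≡ (s - t) - (x - y)
    combine₂ = solve-∀

  -- Equality spreads from the heads: each adjacent sum determines the next entry by cancellation.
  zipWith-∷ʳ-injective : ∀ {k x y} (xs ys : Vec (ℤ/ m) k) a b → x ≡ y →
    zipWith _+_ (x ∷ xs) (xs ∷ʳ a) ≡ zipWith _+_ (y ∷ ys) (ys ∷ʳ b) → x ∷ xs ≡ y ∷ ys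
  zipWith-∷ʳ-injective [] [] _ _ x≡y _ = cong (_∷ []) x≡y
  zipWith-∷ʳ-injective {x = x} (x₁ ∷ xs) (y₁ ∷ ys) a b refl eq =
    cong (x ∷_) (zipWith-∷ʳ-injective xs ys a b
      (+-cancelˡ x x₁ y₁ (proj₁ (∷-injective eq))) (proj₂ (∷-injective eq)))

-- With `i` equal to `q * 2 ^ l`, cancelling `2 ^ l` leaves `a` dividing `2 * q`, and an odd `a`
-- then divides `q`.
2ˡ*a∣2*i∧2ˡ∣i⇒2ˡ*a∣i : ∀ l {a i} → 2 ∤ a → 2 ^ l * a ℕ.∣ 2 * i → 2 ^ l ℕ.∣ i → 2 ^ l * a ℕ.∣ i
2ˡ*a∣2*i∧2ˡ∣i⇒2ˡ*a∣i l {a} {i} 2∤a 2ˡa∣2i (ℕ.divides q refl) =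
  subst (2 ^ l * a ℕ.∣_) (ℕ.*-comm (2 ^ l) q) (ℕ.*-monoʳ-∣ (2 ^ l) a∣q)
  where
  instance _ = ℕ.m^n≢0 2 l
  swap : 2 * (q * 2 ^ l) ≡ 2 ^ l * (2 * q)
  swap = trans (sym (ℕ.*-assoc 2 q (2 ^ l))) (ℕ.*-comm (2 * q) (2 ^ l))
  a∣q : a ℕ.∣ q
  a∣q = coprime-divisor (2∤⇒coprime 2∤a) (ℕ.*-cancelˡ-∣ (2 ^ l) (subst (2 ^ l * a ℕ.∣_) swap 2ˡa∣2i))

-- Elements of cycles have sums divisible by powers of 2.

module _ {m n : ℕ} .{{_ : NonZero m}} where

  open Endo (Vec (ℤ/ m) n) using (^-homo) renaming (_^_ to _^^_)

  K⇒D-image : ∀ {u} → u ∈ K m n → ∃ λ w → w ∈ K m n × u ≡ D w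
  K⇒D-image {u} (v , α , suc β , _ , u≡ , eq) =
    -- The period is `suc β`, so `β` steps after `(D ^^ α) v` comes the predecessor of `u` on the
    -- cycle.
    (D ^^ (β ℕ.+ α)) v , (v , β ℕ.+ α , suc β , s≤s z≤n , sym periodic , periodic) , image
    where
    open ≡-Reasoning
    periodic : (D ^^ ((β ℕ.+ α) ℕ.+ suc β)) v ≡ (D ^^ (β ℕ.+ α)) v
    periodic = begin
      (D ^^ ((β ℕ.+ α) ℕ.+ suc β)) v    ≡⟨ cong (λ k → (D ^^ k) v) (ℕ.+-assoc β α (suc β)) ⟩
      (D ^^ (β ℕ.+ (α ℕ.+ suc β))) v    ≡⟨ cong-app (^-homo D β (α ℕ.+ suc β)) v ⟩
      (D ^^ β) ((D ^^ (α ℕ.+ suc β)) v) ≡⟨ cong (D ^^ β) eq ⟩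
      (D ^^ β) ((D ^^ α) v)             ≡⟨ cong-app (^-homo D β α) v ⟨
      (D ^^ (β ℕ.+ α)) v                ∎
    image : u ≡ D ((D ^^ (β ℕ.+ α)) v)
    image = trans u≡ (cong (λ k → (D ^^ k) v) (ℕ.+-comm α (suc β)))

  -- Induction on the exponent: stepping back along the cycle from `u` to `w` keeps membership in
  -- `K`, and the doubling of the sum by `D` supplies one more factor 2.
  K⇒2ᵏ∣sum : ∀ k → 2 ^ k ℕ.∣ m → ∀ {u} → u ∈ K m n → + (2 ^ k) ∣ ⟦ sum u ⟧
  K⇒2ᵏ∣sum zero    _      _   = ∣ᵤ⇒∣ (ℕ.1∣ _)
  K⇒2ᵏ∣sum (suc k) 2¹⁺ᵏ∣m u∈K with w , w∈K , refl ← K⇒D-image u∈K =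
    ∣2*sum⇒∣sum-D w (∣ᵤ⇒∣ 2¹⁺ᵏ∣m)
      (subst (_∣ + 2 ℤ.* ⟦ sum w ⟧) (sym (ℤ.pos-* 2 (2 ^ k)))
        (*-monoʳ-∣ (+ 2) (K⇒2ᵏ∣sum k (ℕ.m*n∣⇒n∣ 2 (2 ^ k) 2¹⁺ᵏ∣m) w∈K)))

-- Injectivity of `D` on balanced vectors, and their periodicity.

module _ {m n : ℕ} (l m₁ : ℕ) .{{_ : NonZero m}}
  (2∤n : 2 ∤ n) (2∤m₁ : 2 ∤ m₁) (m≡ : m ≡ 2 ^ l * m₁) where

  open Endo (Vec (ℤ/ m) n) using () renaming (_^_ to _^^_)

  2ˡ∣m : + (2 ^ l) ∣ + m
  2ˡ∣m = ∣ᵤ⇒∣ (subst (2 ^ l ℕ.∣_) (sym m≡) (ℕ.m∣m*n m₁))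

  Balanced : Vec (ℤ/ m) n → Set
  Balanced x = + (2 ^ l) ∣ ⟦ sum x ⟧

  2ˡ∣i∧m∣2*i⇒m∣i : ∀ i → + (2 ^ l) ∣ i → + m ∣ + 2 ℤ.* i → + m ∣ i
  2ˡ∣i∧m∣2*i⇒m∣i i 2ˡ∣i m∣2i = ∣ᵤ⇒∣ (subst (ℕ._∣ ℤ.∣ i ∣) (sym m≡)
    (2ˡ*a∣2*i∧2ˡ∣i⇒2ˡ*a∣i l 2∤m₁
      (subst₂ ℕ._∣_ m≡ (ℤ.∣i*j∣≡∣i∣*∣j∣ (+ 2) i) (∣⇒∣ᵤ m∣2i))
      (∣⇒∣ᵤ 2ˡ∣i)))

  D-injective : ∀ x y → Balanced x → Balanced y → D x ≡ D y → x ≡ y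
  D-injective [] [] _ _ _ = refl
  D-injective (x ∷ xs) (y ∷ ys) 2ˡ∣x 2ˡ∣y eq = zipWith-∷ʳ-injective xs ys x y heads eq
    where
    double : ∀ x y → (x ℤ.+ x) - (y ℤ.+ y) ≡ + 2 ℤ.* (x - y)
    double = solve-∀
    cancel : ∀ s d → s - (s - d) ≡ d
    cancel = solve-∀
    -- Appending the heads themselves closes the cycle: the first component becomes `m` dividing
    -- twice the difference of the heads.
    alternation = differences-alternate 2∤n x y xs ys x y eq
    heads : x ≡ y
    heads = ∣-difference⇒≡ x y (2ˡ∣i∧m∣2*i⇒m∣i (⟦ x ⟧ - ⟦ y ⟧)
      (subst (_ ∣_) (cancel (⟦ sum (x ∷ xs) ⟧ - ⟦ sum (y ∷ ys) ⟧) (⟦ x ⟧ - ⟦ y ⟧))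
        (∣m∣n⇒∣m-n (∣m∣n⇒∣m-n 2ˡ∣x 2ˡ∣y) (∣-trans 2ˡ∣m (proj₂ alternation))))
      (subst (_ ∣_) (double ⟦ x ⟧ ⟦ y ⟧) (proj₁ alternation)))

  D-balanced : ∀ x → Balanced x → Balanced (D x)
  D-balanced x 2ˡ∣x = ∣2*sum⇒∣sum-D x 2ˡ∣m (∣n⇒∣m*n (+ 2) 2ˡ∣x)

  D^-balanced : ∀ k x → Balanced x → Balanced ((D ^^ k) x)
  D^-balanced zero    x 2ˡ∣x = 2ˡ∣x
  D^-balanced (suc k) x 2ˡ∣x = D-balanced ((D ^^ k) x) (D^-balanced k x 2ˡ∣x)

  -- All iterates of a balanced vector are balanced, so injectivity strips one `D` from both sides
  -- at a time until the smaller exponent is 0.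
  D^-cancel : ∀ {i j} x → Balanced x → i < j → (D ^^ i) x ≡ (D ^^ j) x →
    ∃ λ β → 1 ≤ β × (D ^^ β) x ≡ x
  D^-cancel {zero}  {j}     x _    0<j eq = j , 0<j , sym eq
  D^-cancel {suc i} {suc j} x 2ˡ∣x i<j eq = D^-cancel x 2ˡ∣x (s<s⁻¹ i<j)
    (D-injective _ _ (D^-balanced i x 2ˡ∣x) (D^-balanced j x 2ˡ∣x) eq)

  balanced⇒periodic : ∀ x → Balanced x → ∃ λ β → 1 ≤ β × (D ^^ β) x ≡ x
  balanced⇒periodic x 2ˡ∣x
    -- The first `m ^ n + 1` iterates, starting from `x` itself, share `m ^ n` codes.
    with i , j , i<j , eq ← pigeonhole (ℕ.n<1+n (m ^ n)) (λ i → funToFin (lookup ((D ^^ toℕ i) x))) =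
    D^-cancel x 2ˡ∣x i<j (lookup-funToFin-injective eq)

theorem3 : (m n l m₁ : ℕ) .{{_ : NonZero m}} → 2 ∤ n → 2 ∤ m₁ → 1 ≤ l →
    m ≡ 2 ^ l * m₁ →
    K m n ≐ (λ x → sum x ≡ 0# [mod 2 ^ l ])
theorem3 m n l m₁ 2∤n 2∤m₁ _ m≡ = K⊆ , ⊆K
  where
  distance-0# : ∀ (s : ℤ/ m) → ℕ.∣ toℕ s - toℕ (0# {m}) ∣ ≡ toℕ s
  distance-0# s = trans (cong ℕ.∣ toℕ s -_∣ toℕ-0#) (ℕ.∣-∣-identityʳ (toℕ s))

  K⊆ : ∀ {x} → x ∈ K m n → sum x ≡ 0# [mod 2 ^ l ]
  K⊆ {x} x∈K = subst (2 ^ l ℕ.∣_) (sym (distance-0# (sum x)))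
    (∣⇒∣ᵤ (K⇒2ᵏ∣sum l (subst (2 ^ l ℕ.∣_) (sym m≡) (ℕ.m∣m*n m₁)) x∈K))

  ⊆K : ∀ {x} → sum x ≡ 0# [mod 2 ^ l ] → x ∈ K m n
  ⊆K {x} 2ˡ∣
    with β , 1≤β , Dᵝx≡x ← balanced⇒periodic l m₁ 2∤n 2∤m₁ m≡ x
      (∣ᵤ⇒∣ (subst (2 ^ l ℕ.∣_) (distance-0# (sum x)) 2ˡ∣)) =
    -- A periodic vector lies on its own cycle, with no steps before the cycle is entered.
    x , 0 , β , 1≤β , sym Dᵝx≡x , Dᵝx≡x
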